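{- Let $\mathcal{A}=\langle Q,\Sigma,\delta,q_{init},col\rangle$ be a deterministic parity automaton over $\Sigma=\{0,1\}^3$, with $Q=\{q_1,\dots,q_{|Q|}\}$. (1) There is an MLO formula $\mathit{op}^I_{\mathcal{A}}(X,Y,Z_1,\dots,Z_{|Q|},Z)$ such that for every $\mathbf{P}\subseteq\mathbb{N}$ and $W_1,\dots,W_{|Q|}\subseteq\mathbb{N}$, letting $U=\{\langle q_k,m\rangle:m\in W_k\}\subseteq Q\times\mathbb{N}$ be the corresponding memoryless strategy of Player I and $F_U$ its induced operator: for all $\mathbf{X},\mathbf{Y}\subseteq\mathbb{N}$, $\langle\mathbb{N},<\rangle\models\mathit{op}^I_{\mathcal{A}}(\mathbf{X},\mathbf{Y},W_1,\dots,W_{|Q|},\mathbf{P})$ iff $\mathbf{X}=F_U(\mathbf{Y})$. (2) There is an MLO formula $\mathit{op}^{II}_{\mathcal{A}}(X,Y,Z_1,\dots,Z_{|Q|},Z'_1,\dots,Z'_{|Q|},Z)$ such that for every $\mathbf{P}\subseteq\mathbb{N}$ and $W_1,\dots,W_{|Q|},W'_1,\dots,W'_{|Q|}\subseteq\mathbb{N}$, letting $U=\{\langle q_k,0,m\rangle:m\in W_k\}\cup\{\langle q_k,1,m\rangle:m\in W'_k\}$ be the corresponding memoryless strategy of Player II and $F_U$ its induced operator: $\langle\mathbb{N},<\rangle\models\mathit{op}^{II}_{\mathcal{A}}(\mathbf{X},\mathbf{Y},W_1,\dots,W'_{|Q|},\mathbf{P})$ iff $\mathbf{Y}=F_U(\mathbf{X})$.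 (3) Moreover, there is an algorithm computing $\mathit{op}^I_{\mathcal{A}}$ and $\mathit{op}^{II}_{\mathcal{A}}$ from $\mathcal{A}$.
   Context: A deterministic parity automaton has finite state set $Q$, transition $\delta:Q\times\Sigma\to Q$, initial state $q_{init}$, colouring $col:Q\to\mathbb{N}$. MLO is monadic second-order logic over $<$ on $\mathbb{N}$; subsets of $\mathbb{N}$ are identified with $\omega$-strings over $\{0,1\}$. Game graph $G_{\mathcal{A},\mathbf{P}}$ ($\mathbf{P}\subseteq\mathbb{N}$): $V_1=Q\times\mathbb{N}$ (Player I), $V_2=Q\times\{0,1\}\times\mathbb{N}$ (Player II). From $\langle q,n\rangle$ an edge labelled $0$ goes to $\langle q,0,n\rangle$ and one labelled $1$ to $\langle q,1,n\rangle$. From $\langle q,a,n\rangle$, with $c=1$ if $n\in\mathbf{P}$ and $c=0$ otherwise, an edge labelled $b$ goes to $\langle\delta(q,\langle a,b,c\rangle),n+1\rangle$ ($b\in\{0,1\}$). Plays start at $\langle q_{init},0\rangle$. For $U\subseteq V_1$ (resp. $V_2$), the memoryless strategy takes, at each node $v$ of its owner, the edge labelled $1$ iff $v\in U$. Induced operators: for $U\subseteq V_1$ and $b_0b_1\dots\in\{0,1\}^\omega$, take the unique play where Player I follows $U$ and the edges leaving successive $V_2$ nodes are labelled $b_0,b_1,\dots$; with successive $V_1$ nodes $v_0,v_1,\dots$, $F_U(b_0b_1\dots)=a_0a_1\dots$ where $a_i=1$ iff $v_i\in U$. For $U\subseteq V_2$ and $a_0a_1\dots$, take the unique play where the edges leaving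 successive $V_1$ nodes are labelled $a_0,a_1,\dots$ and Player II follows $U$; with successive $V_2$ nodes $w_0,w_1,\dots$, $F_U(a_0a_1\dots)=b_0b_1\dots$ where $b_i=1$ iff $w_i\in U$. -}

module Defs where

open import Data.Nat using (ℕ; zero; suc; _+_)
open import Data.Fin using (Fin; zero; suc; splitAt)
open import Data.Bool using (Bool; true; false; if_then_else_)
open import Data.Product using (_×_; _,_; Σ)
open import Data.Sum using (_⊎_; inj₁; inj₂)
open import Data.Empty using (⊥)
open import Relation.Binary.PropositionalEquality using (_≡_)
open import Relation.Nullary using (¬_)

-- ω-strings over {0,1} = subsets of ℕ (false = 0, true = 1)

ωStr : Set
ωStr = ℕ → Bool

-- Deterministic parity automata over Σ = {0,1}³ with state set Q = Fin n
-- (q_k is the k-th element of Fin n).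

Letter : Set
Letter = Bool × Bool × Bool

record DPA (n : ℕ) : Set where
  field
    δ     : Fin n → Letter → Fin n
    qinit : Fin n
    col   : Fin n → ℕ

-- MLO: monadic second-order logic over (ℕ, <).
-- Formula m k : m first-order variables (Fin m), k set variables (Fin k).

data Formula (m k : ℕ) : Set where
  _<ᶠ_  : Fin m → Fin m → Formula m k
  _≐_   : Fin m → Fin m → Formula m k
  _∈ᶠ_  : Fin m → Fin k → Formula m k
  ⊥ᶠ    : Formula m k
  ¬ᶠ_   : Formula m k → Formula m k
  _∧ᶠ_  : Formula m k → Formula m k → Formula m k
  _∨ᶠ_  : Formula m k → Formula m k → Formula m k
  _⇒ᶠ_  : Formula m k → Formula m k → Formula m k
  ∃¹_   : Formula (suc m) k → Formula m k
  ∀¹_   : Formula (suc m) k → Formula m k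
  ∃²_   : Formula m (suc k) → Formula m k
  ∀²_   : Formula m (suc k) → Formula m k

extend : ∀ {A : Set} {m} → A → (Fin m → A) → Fin (suc m) → A
extend a ρ zero    = a
extend a ρ (suc i) = ρ i

Sat : ∀ {m k} → Formula m k → (Fin m → ℕ) → (Fin k → ωStr) → Set
Sat (x <ᶠ y) ρ σ = ρ x Data.Nat.< ρ y
Sat (x ≐ y)  ρ σ = ρ x ≡ ρ y
Sat (x ∈ᶠ X) ρ σ = σ X (ρ x) ≡ true
Sat ⊥ᶠ       ρ σ = ⊥
Sat (¬ᶠ φ)   ρ σ = ¬ Sat φ ρ σ
Sat (φ ∧ᶠ ψ) ρ σ = Sat φ ρ σ × Sat ψ ρ σ
Sat (φ ∨ᶠ ψ) ρ σ = Sat φ ρ σ ⊎ Sat ψ ρ σ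
Sat (φ ⇒ᶠ ψ) ρ σ = Sat φ ρ σ → Sat ψ ρ σ
Sat (∃¹ φ)   ρ σ = Σ ℕ λ n → Sat φ (extend n ρ) σ
Sat (∀¹ φ)   ρ σ = (n : ℕ) → Sat φ (extend n ρ) σ
Sat (∃² φ)   ρ σ = Σ ωStr λ S → Sat φ ρ (extend S σ)
Sat (∀² φ)   ρ σ = (S : ωStr) → Sat φ ρ (extend S σ)

noFO : Fin 0 → ℕ
noFO ()

-- op^I(X, Y, Z_1..Z_n, Z)
envI : ∀ {n} → ωStr → ωStr → (Fin n → ωStr) → ωStr → Fin (2 + (n + 1)) → ωStr
envI X Y W P zero = X
envI X Y W P (suc zero) = Y
envI {n} X Y W P (suc (suc i)) with splitAt n i
... | inj₁ k = W k
... | inj₂ _ = P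

-- op^II(X, Y, Z_1..Z_n, Z'_1..Z'_n, Z)
envII : ∀ {n} → ωStr → ωStr → (Fin n → ωStr) → (Fin n → ωStr) → ωStr
      → Fin (2 + (n + (n + 1))) → ωStr
envII X Y W W' P zero = X
envII X Y W W' P (suc zero) = Y
envII {n} X Y W W' P (suc (suc i)) with splitAt n i
... | inj₁ k = W k
... | inj₂ j with splitAt n j
...   | inj₁ k = W' k
...   | inj₂ _ = P

-- Player I strategy U = {⟨q_k, m⟩ : m ∈ W_k}; Player II plays Y.
-- stateI i = the Q-component of the i-th V₁ node v_i = ⟨q, i⟩.
stateI : ∀ {n} → DPA n → (Fin n → ωStr) → ωStr → ωStr → ℕ → Fin n
stateI A W P Y zero    = DPA.qinit A
stateI A W P Y (suc i) =
  let q = stateI A W P Y i in DPA.δ A q (W q i , Y i , P i)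

FI : ∀ {n} → DPA n → (Fin n → ωStr) → ωStr → ωStr → ωStr
FI A W P Y i = W (stateI A W P Y i) i

-- Player II strategy U = {⟨q_k,0,m⟩ : m ∈ W_k} ∪ {⟨q_k,1,m⟩ : m ∈ W'_k};
-- Player I plays X.  Node w_i = ⟨q, X i, i⟩.
stratII : ∀ {n} → (Fin n → ωStr) → (Fin n → ωStr) → Fin n → Bool → ℕ → Bool
stratII W W' q a m = if a then W' q m else W q m

stateII : ∀ {n} → DPA n → (Fin n → ωStr) → (Fin n → ωStr) → ωStr → ωStr → ℕ → Fin n
stateII A W W' P X zero    = DPA.qinit A
stateII A W W' P X (suc i) =
  let q = stateII A W W' P X i in DPA.δ A q (X i , stratII W W' q (X i) i , P i)

FII : ∀ {n} → DPA n → (Fin n → ωStr) → (Fin n → ωStr) → ωStr → ωStr → ωStr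
FII A W W' P X i = stratII W W' (stateII A W W' P X i) (X i) i

-- With one existential set variable S_q per state q, the formula guesses the
-- positions at which the automaton's run along the play is in state q, and checks
-- three first-order conditions: 0 ∈ S_{q_init}; if i ∈ S_q then i + 1 ∈ S_{q′}
-- for the state q′ determined by q and the bits read at i; and if i ∈ S_q then the
-- output bit at i is the one determined by q and the bits read at i.  Each is a
-- finite case distinction on the bits at a position.  By induction along ℕ any
-- guess meeting the first two conditions contains the actual run, so the third
-- forces the operator's value; conversely the actual run is a witness.

module Submission where

open import Defs
open import Data.Nat using (ℕ; zero; suc; _+_; _<_)
open import Data.Nat.Properties using (≤-refl; ≤-antisym; ≮⇒≥; ≤⇒≯; m<1+n⇒m≤n; n≤0⇒n≡0; n≮0)
open import Data.Fin using (Fin; zero; suc; _↑ˡ_; _↑ʳ_; splitAt; _≟_)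
open import Data.Fin.Properties using (splitAt-↑ˡ; splitAt-↑ʳ)
open import Data.Vec.Functional using (_∷_; _++_; head; tail)
open import Data.Vec.Functional.Properties using (lookup-++ˡ; lookup-++ʳ)
open import Data.Bool using (Bool; true; false; if_then_else_)
open import Data.Product using (Σ; _×_; _,_; proj₁; proj₂)
open import Data.Sum using (inj₁; inj₂)
open import Data.Empty using (⊥-elim)
open import Relation.Nullary using (yes; does)
open import Relation.Nullary.Decidable using (dec-true)
open import Relation.Binary.PropositionalEquality
  using (_≡_; _≗_; refl; sym; trans; cong; subst)
open import Function.Bundles using (_⇔_; mk⇔; Equivalence)
open import Function.Properties.Equivalence using () renaming (trans to ⇔-trans)

private
  variable
    m n K K′ : ℕ
    A : Set

open Equivalence using (to; from)

Sat-resp-≗ : (φ : Formula m K) {ρ : Fin m → ℕ} {σ σ′ : Fin K → ωStr}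
           → σ ≗ σ′ → Sat φ ρ σ → Sat φ ρ σ′
Sat-resp-≗ (x <ᶠ y)  e h = h
Sat-resp-≗ (x ≐ y)   e h = h
Sat-resp-≗ (x ∈ᶠ X) {ρ} e h = subst (λ S → S (ρ x) ≡ true) (e X) h
Sat-resp-≗ ⊥ᶠ        e h = h
Sat-resp-≗ (¬ᶠ φ)    e h = λ h′ → h (Sat-resp-≗ φ (λ i → sym (e i)) h′)
Sat-resp-≗ (φ ∧ᶠ ψ)  e (a , b) = Sat-resp-≗ φ e a , Sat-resp-≗ ψ e b
Sat-resp-≗ (φ ∨ᶠ ψ)  e (inj₁ a) = inj₁ (Sat-resp-≗ φ e a)
Sat-resp-≗ (φ ∨ᶠ ψ)  e (inj₂ b) = inj₂ (Sat-resp-≗ ψ e b)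
Sat-resp-≗ (φ ⇒ᶠ ψ)  e h = λ a → Sat-resp-≗ ψ e (h (Sat-resp-≗ φ (λ i → sym (e i)) a))
Sat-resp-≗ (∃¹ φ)    e (x , h) = x , Sat-resp-≗ φ e h
Sat-resp-≗ (∀¹ φ)    e h = λ x → Sat-resp-≗ φ e (h x)
Sat-resp-≗ (∃² φ)    e (S , h) = S , Sat-resp-≗ φ (λ { zero → refl ; (suc i) → e i }) h
Sat-resp-≗ (∀² φ)    e h = λ S → Sat-resp-≗ φ (λ { zero → refl ; (suc i) → e i }) (h S)

⋀ : (Fin n → Formula m K) → Formula m K
⋀ {zero}  f = ¬ᶠ ⊥ᶠ
⋀ {suc n} f = f zero ∧ᶠ ⋀ (λ j → f (suc j))

Sat-⋀ : (f : Fin n → Formula m K) {ρ : Fin m → ℕ} {σ : Fin K → ωStr}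
      → Sat (⋀ f) ρ σ ⇔ (∀ k → Sat (f k) ρ σ)
Sat-⋀ {zero}  f = mk⇔ (λ _ ()) (λ _ ())
Sat-⋀ {suc n} f = mk⇔
  (λ { (h₀ , hs) zero → h₀ ; (h₀ , hs) (suc k) → to (Sat-⋀ (λ j → f (suc j))) hs k })
  (λ h → h zero , from (Sat-⋀ (λ j → f (suc j))) (λ k → h (suc k)))

∃²ⁿ : Formula m (n + K) → Formula m K
∃²ⁿ {n = zero}  φ = φ
∃²ⁿ {n = suc n} φ = ∃²ⁿ {n = n} (∃² φ)

extend-++ : (S : Fin (suc n) → ωStr) (σ : Fin K → ωStr)
          → extend (head S) (tail S ++ σ) ≗ S ++ σ
extend-++ S σ zero = refl
extend-++ {n} S σ (suc i) with splitAt n i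
... | inj₁ _ = refl
... | inj₂ _ = refl

Sat-∃²ⁿ : (φ : Formula m (n + K)) {ρ : Fin m → ℕ} {σ : Fin K → ωStr}
        → Sat (∃²ⁿ φ) ρ σ ⇔ Σ (Fin n → ωStr) (λ S → Sat φ ρ (S ++ σ))
Sat-∃²ⁿ {n = zero}  φ = mk⇔ (λ h → (λ ()) , h) proj₂
Sat-∃²ⁿ {n = suc n} φ {ρ} {σ} = mk⇔
  (λ h → let (S , T , hφ) = to (Sat-∃²ⁿ (∃² φ)) h
         in T ∷ S , Sat-resp-≗ φ (extend-++ (T ∷ S) σ) hφ)
  (λ (S , hφ) → from (Sat-∃²ⁿ (∃² φ))
     (tail S , head S , Sat-resp-≗ φ (λ i → sym (extend-++ S σ i)) hφ))

isZeroᶠ : Fin m → Formula m K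
isZeroᶠ x = ¬ᶠ (∃¹ (zero <ᶠ suc x))

Sat-isZeroᶠ : (x : Fin m) {ρ : Fin m → ℕ} {σ : Fin K → ωStr}
            → Sat (isZeroᶠ x) ρ σ ⇔ ρ x ≡ 0
Sat-isZeroᶠ x = mk⇔
  (λ h → n≤0⇒n≡0 (≮⇒≥ (λ 0<x → h (0 , 0<x))))
  (λ x≡0 (z , z<x) → n≮0 (subst (z <_) x≡0 z<x))

_≺ᶠ_ : Fin m → Fin m → Formula m K
x ≺ᶠ y = (x <ᶠ y) ∧ᶠ (¬ᶠ (∃¹ ((suc x <ᶠ zero) ∧ᶠ (zero <ᶠ suc y))))

Sat-≺ᶠ : (x y : Fin m) {ρ : Fin m → ℕ} {σ : Fin K → ωStr}
       → Sat (x ≺ᶠ y) ρ σ ⇔ ρ y ≡ suc (ρ x)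
Sat-≺ᶠ x y {ρ} = mk⇔
  (λ (x<y , nothingBetween) →
     ≤-antisym (≮⇒≥ (λ 1+x<y → nothingBetween (suc (ρ x) , ≤-refl , 1+x<y))) x<y)
  (λ y≡1+x → subst (ρ x <_) (sym y≡1+x) ≤-refl
           , λ (z , x<z , z<y) → ≤⇒≯ (m<1+n⇒m≤n (subst (z <_) y≡1+x z<y)) x<z)

_[_]≐_ : Fin K → Fin m → Bool → Formula m K
V [ x ]≐ true  = x ∈ᶠ V
V [ x ]≐ false = ¬ᶠ (x ∈ᶠ V)

Sat-[]≐ : (V : Fin K) (x : Fin m) (b : Bool) {ρ : Fin m → ℕ} {σ : Fin K → ωStr}
        → Sat (V [ x ]≐ b) ρ σ ⇔ σ V (ρ x) ≡ b
Sat-[]≐ V x true  = mk⇔ (λ h → h) (λ h → h)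
Sat-[]≐ V x false {ρ} {σ} with σ V (ρ x)
... | true  = mk⇔ (λ h → ⊥-elim (h refl)) (λ ())
... | false = mk⇔ (λ _ → refl) (λ _ ())

-- A query reads bits of set variables at the current position, each choice of
-- variable depending on the bits read so far, and returns a value.
data Query (K : ℕ) (A : Set) : Set where
  answer : A → Query K A
  read   : Fin K → (Bool → Query K A) → Query K A

eval : Query K A → (Fin K → ωStr) → ℕ → A
eval (answer a) σ i = a
eval (read V k) σ i = eval (k (σ V i)) σ i

renameVars : (Fin K → Fin K′) → Query K A → Query K′ A
renameVars r (answer a) = answer a
renameVars r (read V k) = read (r V) (λ b → renameVars r (k b))

eval-renameVars : (r : Fin K → Fin K′) {σ : Fin K → ωStr} {τ : Fin K′ → ωStr}
                → (∀ V → τ (r V) ≡ σ V) → (t : Query K A) (i : ℕ)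
                → eval (renameVars r t) τ i ≡ eval t σ i
eval-renameVars r e (answer a) i = refl
eval-renameVars r {σ} {τ} e (read V k) i
  rewrite e V = eval-renameVars r e (k (σ V i)) i

caseᶠ : Fin m → Query K A → (A → Formula m K) → Formula m K
caseᶠ x (answer a) ψ = ψ a
caseᶠ x (read V k) ψ = ((x ∈ᶠ V) ∧ᶠ caseᶠ x (k true) ψ) ∨ᶠ ((¬ᶠ (x ∈ᶠ V)) ∧ᶠ caseᶠ x (k false) ψ)

Sat-caseᶠ : (x : Fin m) (t : Query K A) (ψ : A → Formula m K) {ρ : Fin m → ℕ} {σ : Fin K → ωStr}
          → Sat (caseᶠ x t ψ) ρ σ ⇔ Sat (ψ (eval t σ (ρ x))) ρ σ
Sat-caseᶠ x (answer a) ψ = mk⇔ (λ h → h) (λ h → h)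
Sat-caseᶠ x (read V k) ψ {ρ} {σ} with σ V (ρ x)
... | true  = mk⇔ (λ { (inj₁ (_ , h)) → to (Sat-caseᶠ x (k true) ψ) h
                     ; (inj₂ (x∉V , _)) → ⊥-elim (x∉V refl) })
                  (λ h → inj₁ (refl , from (Sat-caseᶠ x (k true) ψ) h))
... | false = mk⇔ (λ { (inj₁ (() , _)) ; (inj₂ (_ , h)) → to (Sat-caseᶠ x (k false) ψ) h })
                  (λ h → inj₂ ((λ ()) , from (Sat-caseᶠ x (k false) ψ) h))

-- Both induced operators are outputs of such machines, reading the strategy sets,
-- the opponent's moves and P.
record Transducer (n K : ℕ) : Set where
  field
    initial : Fin n
    step    : Fin n → Query K (Fin n)
    out     : Fin n → Query K Bool

module _ {n K : ℕ} (T : Transducer n K) where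
  open Transducer T

  run : (Fin K → ωStr) → ℕ → Fin n
  run σ zero    = initial
  run σ (suc i) = eval (step (run σ i)) σ i

  output : (Fin K → ωStr) → ωStr
  output σ i = eval (out (run σ i)) σ i

  stateVar : Fin n → Fin (n + K)
  stateVar q = q ↑ˡ K

  inputs : Query K A → Query (n + K) A
  inputs = renameVars (n ↑ʳ_)

  initialᶠ : Formula 0 (n + K)
  initialᶠ = ∀¹ (isZeroᶠ zero ⇒ᶠ (zero ∈ᶠ stateVar initial))

  -- de Bruijn: suc zero is the position i and zero is its successor i + 1.
  stepClauseᶠ : Fin n → Formula 2 (n + K)
  stepClauseᶠ q = (suc zero ∈ᶠ stateVar q)
                  ⇒ᶠ caseᶠ (suc zero) (inputs (step q)) (λ q′ → zero ∈ᶠ stateVar q′)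

  stepᶠ : Formula 0 (n + K)
  stepᶠ = ∀¹ (∀¹ ((suc zero ≺ᶠ zero) ⇒ᶠ ⋀ stepClauseᶠ))

  outClauseᶠ : Fin K → Fin n → Formula 1 (n + K)
  outClauseᶠ O q = (zero ∈ᶠ stateVar q) ⇒ᶠ caseᶠ zero (inputs (out q)) ((n ↑ʳ O) [ zero ]≐_)

  outᶠ : Fin K → Formula 0 (n + K)
  outᶠ O = ∀¹ (⋀ (outClauseᶠ O))

  graphᶠ : Fin K → Formula 0 K
  graphᶠ O = ∃²ⁿ (initialᶠ ∧ᶠ (stepᶠ ∧ᶠ outᶠ O))

  module _ (σ : Fin K → ωStr) (S : Fin n → ωStr) where

    ++-stateVar : ∀ q i → (S ++ σ) (stateVar q) i ≡ S q i
    ++-stateVar q i = cong (λ X → X i) (lookup-++ˡ S σ q)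

    ++-inputVar : ∀ V i → (S ++ σ) (n ↑ʳ V) i ≡ σ V i
    ++-inputVar V i = cong (λ X → X i) (lookup-++ʳ S σ V)

    Sat-caseᶠ-inputs : (x : Fin m) (t : Query K A) (ψ : A → Formula m (n + K)) {ρ : Fin m → ℕ}
                     → Sat (caseᶠ x (inputs t) ψ) ρ (S ++ σ) ⇔ Sat (ψ (eval t σ (ρ x))) ρ (S ++ σ)
    Sat-caseᶠ-inputs x t ψ {ρ} = mk⇔
      (λ h → subst (λ a → Sat (ψ a) ρ (S ++ σ)) eval-inputs (to (Sat-caseᶠ x (inputs t) ψ) h))
      (λ h → from (Sat-caseᶠ x (inputs t) ψ) (subst (λ a → Sat (ψ a) ρ (S ++ σ)) (sym eval-inputs) h))
      where
      eval-inputs : eval (inputs t) (S ++ σ) (ρ x) ≡ eval t σ (ρ x)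
      eval-inputs = eval-renameVars (n ↑ʳ_) (lookup-++ʳ S σ) t (ρ x)

    run-tracked : Sat initialᶠ noFO (S ++ σ) → Sat stepᶠ noFO (S ++ σ)
                → ∀ i → S (run σ i) i ≡ true
    run-tracked hi hs zero = trans (sym (++-stateVar initial 0)) (hi 0 (from (Sat-isZeroᶠ zero {extend 0 noFO} {S ++ σ}) refl))
    run-tracked hi hs (suc i) = trans (sym (++-stateVar _ (suc i)))
      (to (Sat-caseᶠ-inputs (suc zero) (step (run σ i)) _)
        (to (Sat-⋀ stepClauseᶠ) (hs i (suc i) (from (Sat-≺ᶠ (suc zero) zero {extend (suc i) (extend i noFO)} {S ++ σ}) refl)) (run σ i)
          (trans (++-stateVar (run σ i) i) (run-tracked hi hs i))))

    output-forced : (O : Fin K) → (∀ i → S (run σ i) i ≡ true) → Sat (outᶠ O) noFO (S ++ σ)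
                  → σ O ≗ output σ
    output-forced O tracked ho i = trans (sym (++-inputVar O i))
      (to (Sat-[]≐ (n ↑ʳ O) zero (output σ i))
        (to (Sat-caseᶠ-inputs zero (out (run σ i)) _)
          (to (Sat-⋀ (outClauseᶠ O)) (ho i) (run σ i)
            (trans (++-stateVar (run σ i) i) (tracked i)))))

  module _ (σ : Fin K → ωStr) where

    runSets : Fin n → ωStr
    runSets q i = does (run σ i ≟ q)

    runSets-run : ∀ i → runSets (run σ i) i ≡ true
    runSets-run i = dec-true (run σ i ≟ run σ i) refl

    runSets-exact : ∀ q i → runSets q i ≡ true → run σ i ≡ q
    runSets-exact q i h with run σ i ≟ q
    ... | yes r≡q = r≡q

    runSets-next : ∀ q i → runSets q i ≡ true → runSets (eval (step q) σ i) (suc i) ≡ true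
    runSets-next q i h with runSets-exact q i h
    ... | refl = runSets-run (suc i)

    runSets-initial : Sat initialᶠ noFO (runSets ++ σ)
    runSets-initial x x≡0 = trans (++-stateVar σ runSets initial x)
      (subst (λ i → runSets initial i ≡ true) (sym (to (Sat-isZeroᶠ zero {extend x noFO} {runSets ++ σ}) x≡0))
        (runSets-run 0))

    runSets-step : Sat stepᶠ noFO (runSets ++ σ)
    runSets-step x y y≡1+x = from (Sat-⋀ stepClauseᶠ) λ q x∈q →
      from (Sat-caseᶠ-inputs σ runSets (suc zero) (step q) _)
        (trans (++-stateVar σ runSets _ y)
          (subst (λ i → runSets (eval (step q) σ x) i ≡ true)
            (sym (to (Sat-≺ᶠ (suc zero) zero {extend y (extend x noFO)} {runSets ++ σ}) y≡1+x))
            (runSets-next q x (trans (sym (++-stateVar σ runSets q x)) x∈q))))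

    runSets-out : (O : Fin K) → σ O ≗ output σ → Sat (outᶠ O) noFO (runSets ++ σ)
    runSets-out O O≗output x = from (Sat-⋀ (outClauseᶠ O)) λ q x∈q →
      from (Sat-caseᶠ-inputs σ runSets zero (out q) _)
        (from (Sat-[]≐ (n ↑ʳ O) zero _)
          (trans (++-inputVar σ runSets O x)
            (trans (O≗output x)
              (cong (λ q′ → eval (out q′) σ x) (runSets-exact q x (trans (sym (++-stateVar σ runSets q x)) x∈q))))))

  Sat-graphᶠ : (O : Fin K) (σ : Fin K → ωStr) → Sat (graphᶠ O) noFO σ ⇔ σ O ≗ output σ
  Sat-graphᶠ O σ = mk⇔
    (λ h → let (S , hi , hs , ho) = to (Sat-∃²ⁿ (initialᶠ ∧ᶠ (stepᶠ ∧ᶠ outᶠ O)) {noFO} {σ}) h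
           in output-forced σ S O (run-tracked σ S hi hs) ho)
    (λ O≗output → from (Sat-∃²ⁿ (initialᶠ ∧ᶠ (stepᶠ ∧ᶠ outᶠ O)))
       (runSets σ , runSets-initial σ , runSets-step σ , runSets-out σ O O≗output))

≗-⇔ʳ : {f g h : ℕ → Bool} → g ≗ h → (f ≗ g) ⇔ (f ≗ h)
≗-⇔ʳ g≗h = mk⇔ (λ f≗g i → trans (f≗g i) (g≗h i)) (λ f≗h i → trans (f≗h i) (sym (g≗h i)))

module PlayerI {n : ℕ} (A : DPA n) where
  open DPA A

  varX varY varP : Fin (2 + (n + 1))
  varX = zero
  varY = suc zero
  varP = suc (suc (n ↑ʳ zero))

  varW : Fin n → Fin (2 + (n + 1))
  varW q = suc (suc (q ↑ˡ 1))

  play : Transducer n (2 + (n + 1))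
  play = record
    { initial = qinit
    ; step    = λ q → read (varW q) λ a → read varY λ b → read varP λ c → answer (δ q (a , b , c))
    ; out     = λ q → read (varW q) answer
    }

  opᶠ : Formula 0 (2 + (n + 1))
  opᶠ = graphᶠ play varX

  module _ (P : ωStr) (W : Fin n → ωStr) (X Y : ωStr) where

    envI-varW : ∀ q → envI X Y W P (varW q) ≡ W q
    envI-varW q rewrite splitAt-↑ˡ n q 1 = refl

    envI-varP : envI X Y W P varP ≡ P
    envI-varP rewrite splitAt-↑ʳ n 1 zero = refl

    run-play : ∀ i → run play (envI X Y W P) i ≡ stateI A W P Y i
    run-play zero = refl
    run-play (suc i) rewrite run-play i | envI-varW (stateI A W P Y i) | envI-varP = refl

    output-play : output play (envI X Y W P) ≗ FI A W P Y
    output-play i rewrite run-play i | envI-varW (stateI A W P Y i) = refl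

    Sat-opᶠ : Sat opᶠ noFO (envI X Y W P) ⇔ X ≗ FI A W P Y
    Sat-opᶠ = ⇔-trans (Sat-graphᶠ play varX (envI X Y W P)) (≗-⇔ʳ output-play)

module PlayerII {n : ℕ} (A : DPA n) where
  open DPA A

  varX varY varP : Fin (2 + (n + (n + 1)))
  varX = zero
  varY = suc zero
  varP = suc (suc (n ↑ʳ (n ↑ʳ zero)))

  varW varW′ : Fin n → Fin (2 + (n + (n + 1)))
  varW  q = suc (suc (q ↑ˡ (n + 1)))
  varW′ q = suc (suc (n ↑ʳ (q ↑ˡ 1)))

  varStrat : Fin n → Bool → Fin (2 + (n + (n + 1)))
  varStrat q a = if a then varW′ q else varW q

  play : Transducer n (2 + (n + (n + 1)))
  play = record
    { initial = qinit
    ; step    = λ q → read varX λ a → read (varStrat q a) λ b → read varP λ c → answer (δ q (a , b , c))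
    ; out     = λ q → read varX λ a → read (varStrat q a) answer
    }

  opᶠ : Formula 0 (2 + (n + (n + 1)))
  opᶠ = graphᶠ play varY

  module _ (P : ωStr) (W W′ : Fin n → ωStr) (X Y : ωStr) where

    envII-varStrat : ∀ q a i → envII X Y W W′ P (varStrat q a) i ≡ stratII W W′ q a i
    envII-varStrat q true  i rewrite splitAt-↑ʳ n (n + 1) (q ↑ˡ 1) | splitAt-↑ˡ n q 1 = refl
    envII-varStrat q false i rewrite splitAt-↑ˡ n q (n + 1) = refl

    envII-varP : envII X Y W W′ P varP ≡ P
    envII-varP rewrite splitAt-↑ʳ n (n + 1) (n ↑ʳ zero) | splitAt-↑ʳ n 1 zero = refl

    run-play : ∀ i → run play (envII X Y W W′ P) i ≡ stateII A W W′ P X i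
    run-play zero = refl
    run-play (suc i) rewrite run-play i | envII-varStrat (stateII A W W′ P X i) (X i) i | envII-varP = refl

    output-play : output play (envII X Y W W′ P) ≗ FII A W W′ P X
    output-play i rewrite run-play i = envII-varStrat (stateII A W W′ P X i) (X i) i

    Sat-opᶠ : Sat opᶠ noFO (envII X Y W W′ P) ⇔ Y ≗ FII A W W′ P X
    Sat-opᶠ = ⇔-trans (Sat-graphᶠ play varY (envII X Y W W′ P)) (≗-⇔ʳ output-play)

lemma6p8 : Σ ((n : ℕ) → DPA n → Formula 0 (2 + (n + 1)) × Formula 0 (2 + (n + (n + 1))))
             (λ alg → (n : ℕ) (A : DPA n)
               → ((P : ωStr) (W : Fin n → ωStr) (X Y : ωStr)
                    → Sat (proj₁ (alg n A)) noFO (envI X Y W P)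
                      ⇔ ((i : ℕ) → X i ≡ FI A W P Y i))
               × ((P : ωStr) (W W' : Fin n → ωStr) (X Y : ωStr)
                    → Sat (proj₂ (alg n A)) noFO (envII X Y W W' P)
                      ⇔ ((i : ℕ) → Y i ≡ FII A W W' P X i)))
lemma6p8 = (λ n A → PlayerI.opᶠ A , PlayerII.opᶠ A)
         , (λ n A → PlayerI.Sat-opᶠ A , PlayerII.Sat-opᶠ A)
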